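{- Let $K\in\mathbb{E}_{Büchi}$ and let $\dot-$ be a contraction function on $K$. Then $\dot-$ is rational and remains in $\mathbb{E}_{Büchi}$ if and only if $\dot-=\dot-_\gamma$ for some Büchi choice function $\gamma$.
   Context: Fix a finite nonempty $AP$. LTL formulae $\varphi::=\bot\mid p\mid\neg\varphi\mid\varphi\lor\varphi\mid X\varphi\mid\varphi U\varphi$ with standard semantics on traces in $(2^{AP})^\omega$; $\mathrm{Cn}_{LTL}(X)$ = formulae satisfied by every (finite) Kripke structure all of whose traces satisfy all of $X$; $\varphi\equiv\psi$ iff $\mathrm{Cn}_{LTL}(\{\varphi\})=\mathrm{Cn}_{LTL}(\{\psi\})$; $K+\varphi:=\mathrm{Cn}_{LTL}(K\cup\{\varphi\})$. Büchi automata over $2^{AP}$ (runs from initial states visiting recurrence states infinitely often), language $\mathcal{L}(A)$, $\mathrm{supp}(A):=\{\varphi\mid\pi\models\varphi\ \forall\pi\in\mathcal{L}(A)\}$; $\mathbb{E}_{Büchi}:=\{\mathrm{supp}(A)\mid A$ Büchi automaton$\}$. A contraction function on theory $K$ maps each formula $\varphi$ to $K\dot-\varphi$; rational means: (K1) $K\dot-\varphi=\mathrm{Cn}_{LTL}(K\dot-\varphi)$; (K2) $K\dot-\varphi\subseteq K$; (K3) $\varphi\notin K\Rightarrow K\dot-\varphi=K$; (K4) $\varphi\notin\mathrm{Cn}_{LTL}(\emptyset)\Rightarrow\varphi\notin K\dot-\varphi$; (K5) $K\subseteq(K\dot-\varphi)+\varphi$; (K6) $\varphi\equiv\psi\Rightarrow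 K\dot-\varphi=K\dot-\psi$. It remains in $\mathbb{E}_{Büchi}$ if all values lie in $\mathbb{E}_{Büchi}$. A Büchi choice function $\gamma$ maps each LTL formula to a Büchi automaton such that (BF1) $\mathcal{L}(\gamma(\varphi))\neq\emptyset$; (BF2) if $\varphi$ is not a tautology then $\neg\varphi\in\mathrm{supp}(\gamma(\varphi))$; (BF3) if $\varphi\equiv\psi$ then $\mathcal{L}(\gamma(\varphi))=\mathcal{L}(\gamma(\psi))$. The Büchi contraction function induced by $\gamma$ on $K$ is $K\dot-_\gamma\varphi:=K\cap\mathrm{supp}(\gamma(\varphi))$ if $\varphi\notin\mathrm{Cn}_{LTL}(\emptyset)$ and $\varphi\in K$, and $K\dot-_\gamma\varphi:=K$ otherwise. -}

module Defs where

open import Level using (0ℓ)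
open import Data.Nat using (ℕ; suc; _≤_; _<_)
open import Data.Fin using (Fin)
open import Data.Fin.Subset using (Subset; Nonempty) renaming (_∈_ to _∈ₛ_)
open import Data.Product using (_×_; ∃-syntax; Σ-syntax)
open import Data.Sum using (_⊎_)
open import Data.Empty using (⊥)
open import Relation.Binary.PropositionalEquality using (_≡_)
open import Relation.Nullary using (¬_)
open import Relation.Unary
  using (Pred; _∈_; _∉_; _⊆_; _≐_; _∪_; _∩_; ∅; ｛_｝; Satisfiable)

-- Throughout, the finite set AP of atomic propositions is Fin n, and sets of
-- formulae and of traces are predicates compared by extensional equality _≐_.

data Formula (n : ℕ) : Set where
  ⊥′   : Formula n
  atom : Fin n → Formula n
  ¬′_  : Formula n → Formula n
  _∨′_ : Formula n → Formula n → Formula n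
  X′_  : Formula n → Formula n
  _U′_ : Formula n → Formula n → Formula n

infix  8 ¬′_ X′_
infixr 6 _∨′_
infixr 7 _U′_

FormulaSet : ℕ → Set₁
FormulaSet n = Pred (Formula n) 0ℓ

-- The alphabet 2^AP.
Letter : ℕ → Set
Letter n = Subset n

Trace : ℕ → Set
Trace n = ℕ → Letter n

private variable n : ℕ

-- π , i ⊨ φ: the suffix of π starting at position i satisfies φ.
infix 4 _,_⊨_ _⊨_

_,_⊨_ : Trace n → ℕ → Formula n → Set
π , i ⊨ ⊥′       = ⊥
π , i ⊨ atom p   = p ∈ₛ π i
π , i ⊨ ¬′ φ     = ¬ (π , i ⊨ φ)
π , i ⊨ φ ∨′ ψ   = (π , i ⊨ φ) ⊎ (π , i ⊨ ψ)
π , i ⊨ X′ φ     = π , suc i ⊨ φ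
π , i ⊨ φ U′ ψ   =
  ∃[ k ] i ≤ k × (π , k ⊨ ψ) × (∀ j → i ≤ j → j < k → π , j ⊨ φ)

_⊨_ : Trace n → Formula n → Set
π ⊨ φ = π , 0 ⊨ φ

record KripkeStructure (n : ℕ) : Set where
  field
    size     : ℕ
    initial  : Subset size
    nonempty : Nonempty initial
    succs    : Fin size → Subset size
    total    : ∀ s → Nonempty (succs s)
    label    : Fin size → Letter n

Traces : KripkeStructure n → Pred (Trace n) 0ℓ
Traces M π = Σ[ ρ ∈ (ℕ → Fin size) ]
      ρ 0 ∈ₛ initial
    × (∀ i → ρ (suc i) ∈ₛ succs (ρ i))
    × (∀ i → π i ≡ label (ρ i))
  where open KripkeStructure M

_⊨ᴷ_ : KripkeStructure n → Formula n → Set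
M ⊨ᴷ φ = ∀ π → π ∈ Traces M → π ⊨ φ

Cn : FormulaSet n → FormulaSet n
Cn X φ = ∀ M → (∀ ψ → ψ ∈ X → M ⊨ᴷ ψ) → M ⊨ᴷ φ

infix 4 _≣_

_≣_ : Formula n → Formula n → Set
φ ≣ ψ = Cn ｛ φ ｝ ≐ Cn ｛ ψ ｝

infixl 6 _+_

_+_ : FormulaSet n → Formula n → FormulaSet n
K + φ = Cn (K ∪ ｛ φ ｝)

Tautology : Formula n → Set
Tautology φ = φ ∈ Cn ∅

record Büchi (n : ℕ) : Set where
  field
    size       : ℕ
    initial    : Subset size
    succs      : Fin size → Letter n → Subset size
    recurrence : Subset size

𝓛 : Büchi n → Pred (Trace n) 0ℓ
𝓛 A π = Σ[ ρ ∈ (ℕ → Fin size) ]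
      ρ 0 ∈ₛ initial
    × (∀ i → ρ (suc i) ∈ₛ succs (ρ i) (π i))
    × (∀ i → ∃[ j ] i ≤ j × ρ j ∈ₛ recurrence)
  where open Büchi A

supp : Büchi n → FormulaSet n
supp A φ = ∀ π → π ∈ 𝓛 A → π ⊨ φ

𝔼Büchi : Pred (FormulaSet n) 0ℓ
𝔼Büchi K = ∃[ A ] K ≐ supp A

Contraction : ℕ → Set₁
Contraction n = Formula n → FormulaSet n

record Rational (K : FormulaSet n) (K∸_ : Contraction n) : Set where
  field
    closure        : ∀ φ → (K∸ φ) ≐ Cn (K∸ φ)
    inclusion      : ∀ φ → (K∸ φ) ⊆ K
    vacuity        : ∀ φ → φ ∉ K → (K∸ φ) ≐ K
    success        : ∀ φ → φ ∉ Cn ∅ → φ ∉ (K∸ φ)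
    recovery       : ∀ φ → K ⊆ (K∸ φ) + φ
    extensionality : ∀ φ ψ → φ ≣ ψ → (K∸ φ) ≐ (K∸ ψ)

RemainsIn𝔼Büchi : Contraction n → Set
RemainsIn𝔼Büchi K∸_ = ∀ φ → (K∸ φ) ∈ 𝔼Büchi

record IsBüchiChoice (γ : Formula n → Büchi n) : Set where
  field
    nonempty       : ∀ φ → Satisfiable (𝓛 (γ φ))
    refutes        : ∀ φ → ¬ Tautology φ → ¬′ φ ∈ supp (γ φ)
    extensionality : ∀ φ ψ → φ ≣ ψ → 𝓛 (γ φ) ≐ 𝓛 (γ ψ)

-- Definition by cases on whether φ ∉ Cn ∅ and φ ∈ K; at most one disjunct
-- can hold.
induced : FormulaSet n → (Formula n → Büchi n) → Contraction n
induced K γ φ ψ =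
    ((φ ∉ Cn ∅ × φ ∈ K) × ψ ∈ K ∩ supp (γ φ))
  ⊎ (¬ (φ ∉ Cn ∅ × φ ∈ K) × ψ ∈ K)

{-# OPTIONS --safe #-}

-- LTL formulae have Büchi automata, and a nonempty Büchi automaton accepts all traces of
-- some finite Kripke structure (a lasso).  Hence supports of Büchi automata are closed
-- under Cn, and even satisfy a deduction theorem: ψ ∈ supp A + φ implies ¬φ ∨ ψ ∈ supp A.
-- From left to right, take for γ(φ) an automaton for the φ-refuting traces of an
-- automaton supporting K ∸ φ; success makes it nonempty, and recovery with the deduction
-- theorem shows that intersecting its support with K gives back K ∸ φ.  Equivalent
-- formulae receive the same automaton because γ first passes to a canonical
-- representative of the equivalence class.  From right to left, the intersection of two
-- supports is the support of the union automaton.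
module Submission where

open import Level using (0ℓ)
open import Axiom.ExcludedMiddle using (ExcludedMiddle)
open import Data.Bool using (Bool; true; false; not)
open import Data.Empty using (⊥)
open import Data.Fin using (Fin; toℕ; fromℕ<)
open import Data.Fin.Properties
  using (1↔⊤; 2↔Bool; *↔×; +↔⊎; pigeonhole; toℕ-fromℕ<; toℕ<n)
open import Data.Fin.Subset using (Subset; ⁅_⁆) renaming (_∈_ to _∈ₛ_; ⊥ to ⊥ₛ)
open import Data.Fin.Subset.Properties using (x∈⁅x⁆; x∈⁅y⁆⇒x≡y)
open import Data.List using (List; []; _∷_; _++_; map; allFin; filter; cartesianProductWith)
open import Data.List.Membership.Propositional using () renaming (_∈_ to _∈ˡ_)
open import Data.List.Membership.Propositional.Properties
  using (∈-++⁺ˡ; ∈-++⁺ʳ; ∈-map⁺; ∈-allFin; ∈-cartesianProductWith⁺; ∈-filter⁺; ∈-filter⁻)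
open import Data.List.Properties using (filter-≐; ∷-injectiveˡ)
open import Data.List.Relation.Unary.Any using (here; there)
open import Data.Nat
  using (ℕ; zero; suc; _*_; _⊔_; _≤_; _<_; _≤‴_; ≤‴-refl; ≤‴-reflexive; ≤‴-step; s≤s;
         _≟_; _<?_; NonZero)
open import Data.Nat.GeneralisedArithmetic using (fold)
open import Data.Nat.Induction using (<-rec)
open import Data.Nat.Properties
  using (≤-refl; ≤-trans; ≤-antisym; n≤1+n; <⇒≤; ≮⇒≥; ≤⇒≤‴; ≤‴⇒≤; <-irrefl; <-trans;
         ≤∧≢⇒<; n<1+n; m<n⇒0<n; m⊔n≤o⇒m≤o; m⊔n≤o⇒n≤o)
open import Data.Product using (_×_; _,_; ∃; ∃-syntax; proj₁; proj₂; map₂)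
open import Data.Product.Function.NonDependent.Propositional using (_×-⇔_; _×-↔_)
open import Data.Sum using (_⊎_; inj₁; inj₂; [_,_]; [_,_]′)
import Data.Sum as Sum
import Data.Product as Product
open import Data.Sum.Function.Propositional using (_⊎-⇔_; _⊎-↔_)
open import Data.Sum.Relation.Binary.Pointwise using (Pointwise; inj₁; inj₂)
open import Data.Unit using (⊤; tt)
open import Data.Vec using (tabulate)
open import Data.Vec.Properties using (lookup∘tabulate; lookup⇒[]=; []=⇒lookup)
open import Function using (_∘_; id; const)
open import Function.Bundles using (_⇔_; mk⇔; _↔_; Equivalence; Inverse)
open import Function.Properties.Equivalence using () renaming (trans to ⇔-trans; sym to ⇔-sym)
open import Function.Properties.Inverse using (↔-refl; ↔-trans)
open import Relation.Binary.PropositionalEquality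
  using (_≡_; refl; sym; trans; cong; subst; subst₂)
open import Relation.Nullary using (¬_; yes; no; does; contradiction)
open import Relation.Nullary.Decidable using (dec-true; dec-false; decidable-stable; toSum)
open import Relation.Unary using (Pred; U; _∈_; _∉_; _⊆_; _≐_; _∪_; _∩_; ∅; ｛_｝; Satisfiable)
open import Relation.Unary.Properties using (≐-refl; ≐-sym; ≐-trans)
open import Defs

open Equivalence using (to; from)

private variable
  n k l : ℕ
  A B   : Set

-- Sequences

InfinitelyOften : Pred ℕ 0ℓ → Set
InfinitelyOften P = ∀ i → ∃[ j ] i ≤ j × P j

always : {P : Pred ℕ 0ℓ} → (∀ i → P i) → InfinitelyOften P
always p i = i , ≤-refl , p i

-- Walk from `i` towards `j`: either some step leaves the invariant `G` by exhibiting `H`, or `G`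
-- survives up to `j`. The order `≤‴` fits because its induction advances the lower bound, as the
-- walk does.
invariant-or-exit : {G H : Pred ℕ 0ℓ} → (∀ m → G m → H m ⊎ G (suc m)) →
                    ∀ {i j} → i ≤‴ j → G i → (∃[ c ] i ≤ c × H c) ⊎ G j
invariant-or-exit next ≤‴-refl g = inj₂ g
invariant-or-exit next {i} (≤‴-step i<j) g with next i g
... | inj₁ h  = inj₁ (i , ≤-refl , h)
... | inj₂ g′ = Sum.map₁ (λ (c , i<c , h) → c , <⇒≤ i<c , h)
                         (invariant-or-exit next i<j g′)

Until : Pred ℕ 0ℓ → Pred ℕ 0ℓ → Pred ℕ 0ℓ
Until P Q i = ∃[ k ] i ≤ k × Q k × (∀ j → i ≤ j → j < k → P j)

module _ {P Q : Pred ℕ 0ℓ} where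

  until-fold : ∀ {i} → Q i ⊎ (P i × Until P Q (suc i)) → Until P Q i
  until-fold {i} (inj₁ q) = i , ≤-refl , q , λ j i≤j j<i →
    contradiction (≤-trans j<i i≤j) (<-irrefl refl)
  until-fold {i} (inj₂ (p , k , i<k , q , ps)) = k , <⇒≤ i<k , q , before
    where
    before : ∀ j → i ≤ j → j < k → P j
    before j i≤j j<k with i ≟ j
    ... | yes refl = p
    ... | no i≢j   = ps j (≤∧≢⇒< i≤j i≢j) j<k

  until-unfold : ∀ {i} → Until P Q i → Q i ⊎ (P i × Until P Q (suc i))
  until-unfold {i} (k , i≤k , q , ps) with i ≟ k
  ... | yes refl = inj₁ q
  ... | no i≢k   = inj₂ (ps i ≤-refl i<k , k , i<k , q , λ j i<j → ps j (<⇒≤ i<j))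
    where i<k = ≤∧≢⇒< i≤k i≢k

  -- The expansion law alone has several solutions; fairness singles out the least one.
  until-unique : {R : Pred ℕ 0ℓ} → (∀ i → R i ⇔ (Q i ⊎ (P i × R (suc i)))) →
                 InfinitelyOften (λ i → R i → Q i) → ∀ i → R i ⇔ Until P Q i
  until-unique {R} expand fair i = mk⇔
    (λ r → let j , i≤j , r⇒q = fair i in holds r⇒q (≤⇒≤‴ i≤j) r)
    (λ (k , i≤k , q , ps) → reached q (≤⇒≤‴ i≤k) ps)
    where
    -- Fairness supplies a `j` at which `R` would force `Q`. Unfolding `R` from `i` therefore meets
    -- `Q` at `j` at the latest and cannot be postponed forever.
    holds : ∀ {i j} → (R j → Q j) → i ≤‴ j → R i → Until P Q i
    holds r⇒q ≤‴-refl       r = until-fold (inj₁ (r⇒q r))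
    holds r⇒q (≤‴-step i<j) r =
      until-fold (Sum.map₂ (map₂ (holds r⇒q i<j)) (expand _ .to r))
    reached : ∀ {i k} → Q k → i ≤‴ k → (∀ j → i ≤ j → j < k → P j) → R i
    reached q ≤‴-refl       ps = expand _ .from (inj₁ q)
    reached q (≤‴-step i<k) ps = expand _ .from (inj₂
      ( ps _ ≤-refl (≤‴⇒≤ i<k)
      , reached q i<k (λ j i<j → ps j (<⇒≤ i<j))))

-- Automata over finite state types

-- States form any type in bijection with some `Fin`, and transitions are mere predicates, so that
-- sums, products and guessed bits can be added directly. Subsets of `Fin` reappear only in
-- `toBüchi`.
record Automaton (n : ℕ) : Set₁ where
  field
    State  : Set
    {card} : ℕ
    finite : Fin card ↔ State
    Init   : Pred State 0ℓ
    Step   : State → Letter n → State → Set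
    Acc    : Pred State 0ℓ

open Automaton

record Run (M : Automaton n) (π : Trace n) (ρ : ℕ → State M) : Set where
  constructor mkRun
  field
    starts  : Init M (ρ 0)
    follows : ∀ i → Step M (ρ i) (π i) (ρ (suc i))
    recurs  : InfinitelyOften (λ i → Acc M (ρ i))

open Run

Lang : Automaton n → Pred (Trace n) 0ℓ
Lang M π = ∃ (Run M π)

×-finite : Fin k ↔ A → Fin l ↔ B → Fin (k * l) ↔ (A × B)
×-finite f g = ↔-trans *↔× (f ×-↔ g)

⊎-finite : Fin k ↔ A → Fin l ↔ B → Fin (k Data.Nat.+ l) ↔ (A ⊎ B)
⊎-finite f g = ↔-trans +↔⊎ (f ⊎-↔ g)

fromBüchi : Büchi n → Automaton n
fromBüchi A = record
  { State  = Fin size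
  ; finite = ↔-refl
  ; Init   = _∈ₛ initial
  ; Step   = λ s a t → t ∈ₛ succs s a
  ; Acc    = _∈ₛ recurrence
  } where open Büchi A

Lang-fromBüchi : (A : Büchi n) → Lang (fromBüchi A) ≐ 𝓛 A
Lang-fromBüchi A = (λ (ρ , mkRun init steps recur) → ρ , init , steps , recur)
                 , λ (ρ , init , steps , recur) → ρ , mkRun init steps recur

universal : Automaton n
universal = record
  { State = ⊤ ; finite = 1↔⊤ ; Init = U ; Step = λ _ _ _ → ⊤ ; Acc = U }

universal-run : (π : Trace n) → Run universal π (const tt)
universal-run π = mkRun tt (const tt) (always (const tt))

union : Automaton n → Automaton n → Automaton n
union M N = record
  { State  = State M ⊎ State N
  ; finite = ⊎-finite (finite M) (finite N)
  ; Init   = [ Init M , Init N ]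
  ; Step   = λ s a → Pointwise (λ s t → Step M s a t) (λ s t → Step N s a t) s
  ; Acc    = [ Acc M , Acc N ]
  }

-- The image of `ι` is closed under the steps of `N`, so a run that starts in it never leaves it and
-- can be read back as a run of `M`. This treats both summands of a union.
restrict-run : {M N : Automaton n} (ι : State M → State N) →
  (∀ {s a y} → Step N (ι s) a y → ∃[ t ] y ≡ ι t × Step M s a t) →
  (∀ {s} → Acc N (ι s) → Acc M s) →
  ∀ {π ρ s} → Run N π ρ → ρ 0 ≡ ι s → Init M s → Lang M π
restrict-run {M = M} {N} ι closed acc {π} {ρ} {s} (mkRun _ steps recur) ρ₀≡ιs init =
  proj₁ ∘ path , mkRun init (λ i → proj₂ (proj₂ (next i (path i)))) λ i →
    let j , i≤j , a = recur i in j , i≤j , acc (subst (Acc N) (proj₂ (path j)) a)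
  where
  next : ∀ i → ((t , _) : ∃[ t ] ρ i ≡ ι t) → ∃[ t′ ] ρ (suc i) ≡ ι t′ × Step M t (π i) t′
  next i (t , eq) = closed (subst (λ x → Step N x (π i) (ρ (suc i))) eq (steps i))
  path : ∀ i → ∃[ t ] ρ i ≡ ι t
  path zero    = s , ρ₀≡ιs
  path (suc i) = let t′ , eq , _ = next i (path i) in t′ , eq

Lang-union : (M N : Automaton n) → Lang (union M N) ≐ Lang M ∪ Lang N
Lang-union M N = (λ (ρ , run) → split (ρ 0) refl run) , [ left , right ]′
  where
  split : ∀ {π} {ρ : ℕ → State M ⊎ State N} x → ρ 0 ≡ x → Run (union M N) π ρ →
          Lang M π ⊎ Lang N π
  split (inj₁ s) eq r = inj₁ (restrict-run {M = M} {N = union M N} inj₁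
    (λ { (inj₁ st) → _ , refl , st }) id r eq (subst [ Init M , Init N ] eq (starts r)))
  split (inj₂ s) eq r = inj₂ (restrict-run {M = N} {N = union M N} inj₂
    (λ { (inj₂ st) → _ , refl , st }) id r eq (subst [ Init M , Init N ] eq (starts r)))
  left : Lang M ⊆ Lang (union M N)
  left (ρ , mkRun init steps recur) = inj₁ ∘ ρ , mkRun init (inj₁ ∘ steps) recur
  right : Lang N ⊆ Lang (union M N)
  right (ρ , mkRun init steps recur) = inj₂ ∘ ρ , mkRun init (inj₂ ∘ steps) recur

-- Lassos

module Lassos {n} (A : Büchi n) where
  open Büchi A

  -- An accepting run together with a place to cut it: positions below `N` are kept and `N` is
  -- identified with `i`. The loop then passes a recurrence state on every round.
  record Lasso (π : Trace n) : Set where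
    field
      ρ         : ℕ → Fin size
      i N       : ℕ
      init      : ρ 0 ∈ₛ initial
      steps     : ∀ m → ρ (suc m) ∈ₛ succs (ρ m) (π m)
      i<N       : i < N
      ρi≡ρN     : ρ i ≡ ρ N
      recurrent : ρ i ∈ₛ recurrence

  lasso-exists : ∀ {π} → π ∈ 𝓛 A → Lasso π
  lasso-exists (ρ , init , steps , recur) =
    -- Among `suc size` successive visits to recurrence states, two are at the same state.
    let a , b , a<b , eq = pigeonhole (n<1+n size) (ρ ∘ visit ∘ toℕ)
    in record
      { ρ         = ρ
      ; i         = visit (toℕ a)
      ; N         = visit (toℕ b)
      ; init      = init
      ; steps     = steps
      ; i<N       = visit-mono (≤⇒≤‴ a<b)
      ; ρi≡ρN     = eq
      ; recurrent = visit-recurrent (toℕ a)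
      }
    where
    visit : ℕ → ℕ
    visit zero    = proj₁ (recur 0)
    -- Searching from `suc (visit a)` makes the visits strictly increasing, so the loop has positive
    -- length.
    visit (suc a) = proj₁ (recur (suc (visit a)))
    visit-suc : ∀ a → visit a < visit (suc a)
    visit-suc a = proj₁ (proj₂ (recur (suc (visit a))))
    visit-mono : ∀ {a b} → suc a ≤‴ b → visit a < visit b
    visit-mono {a} ≤‴-refl       = visit-suc a
    visit-mono {a} (≤‴-step a<b) = <-trans (visit-suc a) (visit-mono a<b)
    visit-recurrent : ∀ a → ρ (visit a) ∈ₛ recurrence
    visit-recurrent zero    = proj₂ (proj₂ (recur 0))
    visit-recurrent (suc a) = proj₂ (proj₂ (recur (suc (visit a))))

  module _ {π : Trace n} (lasso : Lasso π) where
    open Lasso lasso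

    step : Fin N → Fin N
    step s with suc (toℕ s) <? N
    ... | yes s+1<N = fromℕ< s+1<N
    ... | no  _     = fromℕ< i<N

    step-next : ∀ s → suc (toℕ s) < N → toℕ (step s) ≡ suc (toℕ s)
    step-next s s+1<N with suc (toℕ s) <? N
    ... | yes p = toℕ-fromℕ< p
    ... | no ¬p = contradiction s+1<N ¬p

    step-wrap : ∀ s → suc (toℕ s) ≡ N → toℕ (step s) ≡ i
    step-wrap s s+1≡N with suc (toℕ s) <? N
    ... | yes p = contradiction p (<-irrefl s+1≡N)
    ... | no ¬p = toℕ-fromℕ< i<N

    ρ-step : ∀ s → ρ (toℕ (step s)) ≡ ρ (suc (toℕ s))
    ρ-step s with suc (toℕ s) ≟ N
    ... | yes eq = trans (cong ρ (step-wrap s eq)) (trans ρi≡ρN (sym (cong ρ eq)))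
    ... | no neq = cong ρ (step-next s (≤∧≢⇒< (toℕ<n s) neq))

    start : Fin N
    start = fromℕ< (m<n⇒0<n i<N)

    lassoStructure : KripkeStructure n
    lassoStructure = record
      { size     = N
      ; initial  = ⁅ start ⁆
      ; nonempty = start , x∈⁅x⁆ start
      ; succs    = λ s → ⁅ step s ⁆
      ; total    = λ s → step s , x∈⁅x⁆ (step s)
      ; label    = λ s → π (toℕ s)
      }

    lassoStructure-trace : Satisfiable (Traces lassoStructure)
    lassoStructure-trace =
      (λ m → π (toℕ (path m))) , path , x∈⁅x⁆ start , (λ m → x∈⁅x⁆ (path (suc m))) , λ _ → refl
      where
      path : ℕ → Fin N
      path = fold start step

    -- Positions of the lasso are mapped back to states by `ρ`. The only non-successor move is the
    -- wrap from `N` to `i`, and there `ρi≡ρN` makes it a legal transition of `A`.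
    lassoStructure-traces⊆ : Traces lassoStructure ⊆ 𝓛 A
    lassoStructure-traces⊆ {τ} (σ , σ₀∈ , σ-steps , τ≡) =
      (λ m → ρ (toℕ (σ m))) , start-initial , successive , λ m →
        let j , m≤j , eq = returns m (≤⇒≤‴ (toℕ<n (σ m))) refl
        in j , m≤j , subst (λ x → ρ x ∈ₛ recurrence) (sym eq) recurrent
      where
      σ-step : ∀ m → σ (suc m) ≡ step (σ m)
      σ-step m = x∈⁅y⁆⇒x≡y _ (σ-steps m)
      start-initial : ρ (toℕ (σ 0)) ∈ₛ initial
      start-initial = subst (λ x → ρ x ∈ₛ initial)
        (sym (trans (cong toℕ (x∈⁅y⁆⇒x≡y _ σ₀∈)) (toℕ-fromℕ< _))) init
      successive : ∀ m → ρ (toℕ (σ (suc m))) ∈ₛ succs (ρ (toℕ (σ m))) (τ m)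
      successive m = subst₂ (λ q a → q ∈ₛ succs (ρ (toℕ (σ m))) a)
        (sym (trans (cong (ρ ∘ toℕ) (σ-step m)) (ρ-step (σ m)))) (sym (τ≡ m))
        (steps (toℕ (σ m)))
      -- Induction on the distance from the current position to `N`: the last position wraps to `i`,
      -- and any other moves one closer to it. Hence `i` recurs.
      returns : ∀ m {x} → suc x ≤‴ N → toℕ (σ m) ≡ x → ∃[ j ] m ≤ j × toℕ (σ j) ≡ i
      returns m (≤‴-reflexive x+1≡N) eq = suc m , n≤1+n m
        , trans (cong toℕ (σ-step m)) (step-wrap (σ m) (trans (cong suc eq) x+1≡N))
      returns m (≤‴-step x+1<N) eq =
        let σm+1<N = subst (λ y → suc y < N) (sym eq) (≤‴⇒≤ x+1<N)
            j , m<j , eq′ = returns (suc m) x+1<N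
              (trans (cong toℕ (σ-step m)) (trans (step-next (σ m) σm+1<N) (cong suc eq)))
        in j , <⇒≤ m<j , eq′

  nonempty⇒structure : Satisfiable (𝓛 A) →
    ∃[ M ] Satisfiable (Traces M) × Traces M ⊆ 𝓛 A
  nonempty⇒structure (π , π∈A) =
    let lasso = lasso-exists π∈A
    in lassoStructure lasso , lassoStructure-trace lasso , lassoStructure-traces⊆ lasso

-- Enumeration of formulae

-- The stages are cumulative: stage `h` lists the formulae of height at most `h`, finitely many
-- because there are finitely many atoms.
formulae : ℕ → List (Formula n)
formulae         zero    = []
formulae {n = n} (suc h) =
  ⊥′ ∷ map atom (allFin n) ++ map ¬′_ φs ++ map X′_ φs
     ++ cartesianProductWith _∨′_ φs φs ++ cartesianProductWith _U′_ φs φs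
  where φs = formulae h

height : Formula n → ℕ
height ⊥′       = 1
height (atom p) = 1
height (¬′ φ)   = suc (height φ)
height (φ ∨′ ψ) = suc (height φ ⊔ height ψ)
height (X′ φ)   = suc (height φ)
height (φ U′ ψ) = suc (height φ ⊔ height ψ)

∈-formulae : (φ : Formula n) → ∀ {h} → height φ ≤ h → φ ∈ˡ formulae h
∈-formulae ⊥′ (s≤s _) = here refl
∈-formulae (atom p) (s≤s _) = there (∈-++⁺ˡ (∈-map⁺ atom (∈-allFin p)))
∈-formulae {n = n} (¬′ φ) (s≤s le) =
  there (∈-++⁺ʳ (map atom (allFin n)) (∈-++⁺ˡ (∈-map⁺ ¬′_ (∈-formulae φ le))))
∈-formulae {n = n} (X′ φ) {suc h} (s≤s le) =
  there (∈-++⁺ʳ (map atom (allFin n)) (∈-++⁺ʳ (map ¬′_ (formulae h))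
    (∈-++⁺ˡ (∈-map⁺ X′_ (∈-formulae φ le)))))
∈-formulae {n = n} (φ ∨′ ψ) {suc h} (s≤s le) =
  there (∈-++⁺ʳ (map atom (allFin n)) (∈-++⁺ʳ (map ¬′_ φs) (∈-++⁺ʳ (map X′_ φs)
    (∈-++⁺ˡ (∈-cartesianProductWith⁺ _∨′_
      (∈-formulae φ (m⊔n≤o⇒m≤o _ _ le)) (∈-formulae ψ (m⊔n≤o⇒n≤o _ _ le)))))))
  where φs = formulae h
∈-formulae {n = n} (φ U′ ψ) {suc h} (s≤s le) =
  there (∈-++⁺ʳ (map atom (allFin n)) (∈-++⁺ʳ (map ¬′_ φs) (∈-++⁺ʳ (map X′_ φs)
    (∈-++⁺ʳ (cartesianProductWith _∨′_ φs φs) (∈-cartesianProductWith⁺ _U′_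
      (∈-formulae φ (m⊔n≤o⇒m≤o _ _ le)) (∈-formulae ψ (m⊔n≤o⇒n≤o _ _ le)))))))
  where φs = formulae h

-- Subsets from predicates, and Büchi automata from finite ones

module Classical (em : ExcludedMiddle 0ℓ) where

  stable : {P : Set} → ¬ ¬ P → P
  stable = decidable-stable em

  does-true : {P : Set} → (does (em {P}) ≡ true) ⇔ P
  does-true {P} = mk⇔ witness (dec-true em)
    where
    witness : does (em {P}) ≡ true → P
    witness eq with em {P}
    ... | yes p = p

  comprehension : Pred (Fin k) 0ℓ → Subset k
  comprehension P = tabulate (λ x → does (em {P x}))

  ∈-comprehension : {P : Pred (Fin k) 0ℓ} → ∀ {x} → x ∈ₛ comprehension P ⇔ P x
  ∈-comprehension {x = x} = ⇔-trans
    (mk⇔ (λ x∈ → trans (sym (lookup∘tabulate _ x)) ([]=⇒lookup x∈))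
         (λ eq → lookup⇒[]= x _ (trans (lookup∘tabulate _ x) eq)))
    does-true

  toBüchi : Automaton n → Büchi n
  toBüchi M = record
    { size       = card M
    ; initial    = comprehension (Init M ∘ state)
    ; succs      = λ s a → comprehension (λ t → Step M (state s) a (state t))
    ; recurrence = comprehension (Acc M ∘ state)
    } where state = Inverse.to (finite M)

  𝓛-toBüchi : (M : Automaton n) → 𝓛 (toBüchi M) ≐ Lang M
  𝓛-toBüchi M =
    (λ (ρ , init , steps , recur) →
       state ∘ ρ , mkRun (∈-comprehension .to init) (∈-comprehension .to ∘ steps)
       (λ i → let j , i≤j , acc = recur i in j , i≤j , ∈-comprehension .to acc))
    , λ {π} (ρ , mkRun init steps recur) →
       index ∘ ρ
       , ∈-comprehension .from (subst (Init M) (state-index _) init)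
       , (λ i → ∈-comprehension .from
            (subst₂ (λ s t → Step M s (π i) t) (state-index _) (state-index _) (steps i)))
       , (λ i → let j , i≤j , acc = recur i
                in j , i≤j , ∈-comprehension .from (subst (Acc M) (state-index _) acc))
    where
    state = Inverse.to (finite M)
    index = Inverse.from (finite M)
    state-index : ∀ s → s ≡ state (index s)
    state-index s = sym (Inverse.strictlyInverseˡ (finite M) s)

  -- The flag alternates between waiting for P (false) and waiting for Q (true), which
  -- turns the conjunction of two Büchi conditions into a single one.
  toggle : Set → Set → Bool → Bool
  toggle P Q false = does (em {P})
  toggle P Q true  = not (does (em {Q}))

  module _ {P Q : Pred ℕ 0ℓ} {f : ℕ → Bool}
           (f-suc : ∀ i → f (suc i) ≡ toggle (P i) (Q i) (f i)) where

    private
      f-next : ∀ i {b} → f i ≡ b → f (suc i) ≡ toggle (P i) (Q i) b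
      f-next i eq = trans (f-suc i) (cong (toggle (P i) (Q i)) eq)

      set : ∀ i → f i ≡ false → P i → f (suc i) ≡ true
      set i eq p = trans (f-next i eq) (dec-true em p)

      reset : ∀ i → f i ≡ true → Q i → f (suc i) ≡ false
      reset i eq q = trans (f-next i eq) (cong not (dec-true em q))

      stay-false : ∀ i → f i ≡ false → P i ⊎ f (suc i) ≡ false
      stay-false i eq with em {P i}
      ... | yes p = inj₁ p
      ... | no ¬p = inj₂ (trans (f-next i eq) (dec-false em ¬p))

      stay-true : ∀ i → f i ≡ true → (f i ≡ true × Q i) ⊎ f (suc i) ≡ true
      stay-true i eq with em {Q i}
      ... | yes q = inj₁ (eq , q)
      ... | no ¬q = inj₂ (trans (f-next i eq) (cong not (dec-false em ¬q)))

      flag? : ∀ i → f i ≡ true ⊎ f i ≡ false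
      flag? i with f i
      ... | true  = inj₁ refl
      ... | false = inj₂ refl

      true≢false : ∀ {b} → b ≡ true → ¬ b ≡ false
      true≢false refl ()

    -- After `Q` is seen with the flag up, the flag drops. It is up again at a later visit, and only
    -- an occurrence of `P` in between can have raised it.
    toggle-sound : InfinitelyOften (λ i → f i ≡ true × Q i) → InfinitelyOften P
    toggle-sound inf i =
      let j , i≤j , fj , qj = inf i
          k , j<k , fk , _  = inf (suc j)
      in [ (λ (c , j<c , p) → c , ≤-trans i≤j (<⇒≤ j<c) , p)
         , (λ eq → contradiction eq (true≢false fk))
         ]′ (invariant-or-exit stay-false (≤⇒≤‴ j<k) (reset j fj qj))

    -- From any position the flag is raised by the next `P` at the latest, and then it stays up
    -- until a `Q` arrives.
    toggle-complete : InfinitelyOften P → InfinitelyOften Q →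
                      InfinitelyOften (λ i → f i ≡ true × Q i)
    toggle-complete infP infQ i =
      let c , i≤c , fc = raised
          j , c≤j , q  = infQ c
      in [ (λ (d , c≤d , fq) → d , ≤-trans i≤c c≤d , fq)
         , (λ fj → j , ≤-trans i≤c c≤j , fj , q)
         ]′ (invariant-or-exit stay-true (≤⇒≤‴ c≤j) fc)
      where
      raised : ∃[ c ] i ≤ c × f c ≡ true
      raised with flag? i
      ... | inj₁ eq = i , ≤-refl , eq
      ... | inj₂ eq =
        let j , i≤j , p = infP i
        in [ (λ (c , i≤c , fc) → suc c , ≤-trans i≤c (n≤1+n c) , fc)
           , (λ fj → suc j , ≤-trans i≤j (n≤1+n j) , set j fj p)
           ]′ (invariant-or-exit {G = λ m → f m ≡ false} (λ m _ → flag? (suc m)) (≤⇒≤‴ i≤j) eq)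

  -- Cascades and synchronous products

  module Cascade {n} (M : Automaton n) (fin : Fin k ↔ B) (Init′ : Pred B 0ℓ)
                 (Step′ : State M × B → Letter n → State M × B → Set)
                 (Acc′ : Pred (State M × B) 0ℓ) where

    -- The steps and acceptance of the second component may inspect the state of `M`. This covers
    -- synchronous products and also bits that guess something about a run of `M`. The initial flag
    -- is left free, since the toggle argument works from either value.
    cascade : Automaton n
    cascade = record
      { State  = (State M × B) × Bool
      ; finite = ×-finite (×-finite (finite M) fin) 2↔Bool
      ; Init   = λ ((s , b) , _) → Init M s × Init′ b
      ; Step   = λ (x@(s , b) , f) a (y@(t , c) , g) →
                   Step M s a t × Step′ x a y × g ≡ toggle (Acc M s) (Acc′ x) f
      ; Acc    = λ (x , f) → f ≡ true × Acc′ x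
      }

    module _ {π : Trace n} where

      cascade-run : ∀ {σ} {β : ℕ → B} → Run M π σ → Init′ (β 0) →
        (∀ i → Step′ (σ i , β i) (π i) (σ (suc i) , β (suc i))) →
        InfinitelyOften (λ i → Acc′ (σ i , β i)) → ∃ (Run cascade π)
      cascade-run {σ} {β} (mkRun init steps recur) init′ steps′ recur′ =
        (λ i → (σ i , β i) , flag i)
        , mkRun (init , init′) (λ i → steps i , steps′ i , refl)
            (toggle-complete {P = Acc M ∘ σ} {Q = λ i → Acc′ (σ i , β i)} {f = flag}
              (λ _ → refl) recur recur′)
        where
        flag : ℕ → Bool
        flag zero    = false
        flag (suc i) = toggle (Acc M (σ i)) (Acc′ (σ i , β i)) (flag i)

      module _ {ρ : ℕ → State cascade} (r : Run cascade π ρ) where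

        base-run : Run M π (proj₁ ∘ proj₁ ∘ ρ)
        base-run = mkRun (proj₁ (starts r)) (proj₁ ∘ follows r)
          (toggle-sound {Q = λ i → Acc′ (proj₁ (ρ i))} {f = proj₂ ∘ ρ}
            (proj₂ ∘ proj₂ ∘ follows r) (recurs r))

        initial′ : Init′ (proj₂ (proj₁ (ρ 0)))
        initial′ = proj₂ (starts r)

        steps′ : ∀ i → Step′ (proj₁ (ρ i)) (π i) (proj₁ (ρ (suc i)))
        steps′ = proj₁ ∘ proj₂ ∘ follows r

        recurrent′ : InfinitelyOften (λ i → Acc′ (proj₁ (ρ i)))
        recurrent′ i = let j , i≤j , _ , acc = recurs r i in j , i≤j , acc

  module Synchronous {n} (M N : Automaton n) where

    second-steps : State M × State N → Letter n → State M × State N → Set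
    second-steps (_ , s) a (_ , t) = Step N s a t

    open Cascade M (finite N) (Init N) second-steps (Acc N ∘ proj₂) public

    second-run : ∀ {π ρ} → Run cascade π ρ → Run N π (proj₂ ∘ proj₁ ∘ ρ)
    second-run r = mkRun (initial′ r) (steps′ r) (recurrent′ r)

    Lang-cascade : Lang cascade ≐ Lang M ∩ Lang N
    Lang-cascade = (λ (_ , r) → (_ , base-run r) , (_ , second-run r))
                 , λ ((_ , r) , (_ , mkRun init steps recur)) → cascade-run r init steps recur

  -- From LTL to Büchi automata

  -- A temporal tester: a nondeterministic transducer whose state announces whether `P` holds at the
  -- current position. Every trace has a run, and all runs over it announce the same truth values,
  -- so negation complements `Out` instead of the automaton.
  record Tester {n} (P : Trace n → ℕ → Set) : Set₁ where
    field
      automaton : Automaton n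
      Out       : Pred (State automaton) 0ℓ
      run       : ∀ π → Lang automaton π
      correct   : ∀ {π ρ} → Run automaton π ρ → ∀ i → Out (ρ i) ⇔ P π i

  open Tester

  falseTester : Tester {n} (λ _ _ → ⊥)
  falseTester = record
    { automaton = universal
    ; Out       = ∅
    ; run       = λ π → _ , universal-run π
    ; correct   = λ _ _ → mk⇔ id id
    }

  -- The state is a guess about the letter about to be read, and the step that reads the letter
  -- checks the guess.
  letterTester : (P : Pred (Letter n) 0ℓ) → Tester (λ π i → P (π i))
  letterTester P = record
    { automaton = record
      { State  = Bool
      ; finite = 2↔Bool
      ; Init   = U
      ; Step   = λ b a _ → (b ≡ true) ⇔ P a
      ; Acc    = U
      }
    ; Out     = _≡ true
    ; run     = λ π → (λ i → does (em {P (π i)})) , mkRun tt (λ _ → does-true) (always (const tt))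
    ; correct = follows
    }

  module _ {n} {P Q : Trace n → ℕ → Set} where

    notTester : Tester P → Tester (λ π i → ¬ P π i)
    notTester T = record
      { automaton = automaton T
      ; Out       = λ s → ¬ Out T s
      ; run       = run T
      ; correct   = λ r i → mk⇔ (λ ¬o p → ¬o (correct T r i .from p))
                                (λ ¬p o → ¬p (correct T r i .to o))
      }

    -- An added bit predicts the output of `T` one position ahead, and the next state confirms or
    -- blocks the prediction.
    nextTester : Tester P → Tester (λ π i → P π (suc i))
    nextTester T = record
      { automaton = cascade
      ; Out       = λ ((_ , b) , _) → b ≡ true
      ; run       = λ π → let σ , r = run T π in
          cascade-run {β = λ i → does (em {Out T (σ (suc i))})} r tt (λ _ → does-true)
            (always (const tt))
      ; correct   = λ r i → ⇔-trans (steps′ r i) (correct T (base-run r) (suc i))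
      }
      where
      predicts : State (automaton T) × Bool → Letter n → State (automaton T) × Bool → Set
      predicts (_ , b) _ (s , _) = (b ≡ true) ⇔ Out T s

      open Cascade (automaton T) 2↔Bool U predicts U

    module _ (T₁ : Tester P) (T₂ : Tester Q) where
      private
        M₁ = automaton T₁
        M₂ = automaton T₂
        module M₁×M₂ = Synchronous M₁ M₂

        pair-run : ∀ π → Lang M₁×M₂.cascade π
        pair-run π = proj₂ M₁×M₂.Lang-cascade (run T₁ π , run T₂ π)

        correct₁ : ∀ {π ρ} → Run M₁×M₂.cascade π ρ →
                   ∀ i → Out T₁ (proj₁ (proj₁ (ρ i))) ⇔ P π i
        correct₁ r = correct T₁ (M₁×M₂.base-run r)

        correct₂ : ∀ {π ρ} → Run M₁×M₂.cascade π ρ →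
                   ∀ i → Out T₂ (proj₂ (proj₁ (ρ i))) ⇔ Q π i
        correct₂ r = correct T₂ (M₁×M₂.second-run r)

      orTester : Tester (λ π i → P π i ⊎ Q π i)
      orTester = record
        { automaton = M₁×M₂.cascade
        ; Out       = λ ((s , t) , _) → Out T₁ s ⊎ Out T₂ t
        ; run       = pair-run
        ; correct   = λ r i → correct₁ r i ⊎-⇔ correct₂ r i
        }

      -- A guessed bit must obey the expansion law of until (`expands`). The acceptance condition
      -- `fulfilled` excludes a bit that stays true forever while `Q` never comes, so `until-unique`
      -- identifies the bit with the until.
      untilTester : Tester (λ π → Until (P π) (Q π))
      untilTester = record
        { automaton = cascade
        ; Out       = λ ((_ , b) , _) → b ≡ true
        ; run       = until-run
        ; correct   = λ {π} r → until-unique {P = P π} {Q = Q π}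
            (λ i → ⇔-trans (steps′ r i)
              (correct₂ (base-run r) i ⊎-⇔ (correct₁ (base-run r) i ×-⇔ mk⇔ id id)))
            (λ i → let j , i≤j , fair = recurrent′ r i
                   in j , i≤j , correct₂ (base-run r) j .to ∘ fair)
        }
        where
        expands : State M₁×M₂.cascade × Bool → Letter n → State M₁×M₂.cascade × Bool → Set
        expands (((s , t) , _) , b) _ (_ , c) =
          (b ≡ true) ⇔ (Out T₂ t ⊎ (Out T₁ s × c ≡ true))

        fulfilled : Pred (State M₁×M₂.cascade × Bool) 0ℓ
        fulfilled (((_ , t) , _) , b) = b ≡ true → Out T₂ t

        open Cascade M₁×M₂.cascade 2↔Bool U expands fulfilled

        until-run : ∀ π → Lang cascade π
        until-run π = let σ , r = pair-run π in
          cascade-run {β = λ i → does (em {Until (P π) (Q π) i})} r tt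
            (λ i → ⇔-trans does-true (⇔-trans (mk⇔ until-unfold until-fold)
              (⇔-sym (correct₂ r i ⊎-⇔ (correct₁ r i ×-⇔ does-true)))))
            (fair r)
          where
          -- If the until holds at `i`, its witness position satisfies `Q`; if it fails, the bit at
          -- `i` is false. Either way a fair position is found.
          fair : ∀ {σ} → Run M₁×M₂.cascade π σ → InfinitelyOften (λ i →
                   does (em {Until (P π) (Q π) i}) ≡ true → Out T₂ (proj₂ (proj₁ (σ i))))
          fair r i with em {Until (P π) (Q π) i}
          ... | yes (k , i≤k , q , _) = k , i≤k , λ _ → correct₂ r k .from q
          ... | no ¬u = i , ≤-refl , λ eq → contradiction (does-true .to eq) ¬u

  initially : {P : Trace n → ℕ → Set} → Tester P → Automaton n
  initially T = record (automaton T) { Init = λ s → Init (automaton T) s × Out T s }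

  Lang-initially : {P : Trace n → ℕ → Set} (T : Tester P) → Lang (initially T) ≐ (λ π → P π 0)
  Lang-initially T =
    (λ (_ , mkRun (init , out) steps recur) → correct T (mkRun init steps recur) 0 .to out)
    , λ {π} p → let ρ , r = run T π
                in ρ , mkRun (starts r , correct T r 0 .from p) (follows r) (recurs r)

  tester : (φ : Formula n) → Tester (λ π i → π , i ⊨ φ)
  tester ⊥′       = falseTester
  tester (atom p) = letterTester (p ∈ₛ_)
  tester (¬′ φ)   = notTester {Q = λ _ _ → ⊥} (tester φ)
  tester (φ ∨′ ψ) = orTester (tester φ) (tester ψ)
  tester (X′ φ)   = nextTester {Q = λ _ _ → ⊥} (tester φ)
  tester (φ U′ ψ) = untilTester (tester φ) (tester ψ)

  -- Supports

  -- Unification would otherwise unfold the automaton of a concrete formula.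
  opaque
    universalBüchi : Büchi n
    universalBüchi = toBüchi universal

    ∈-universalBüchi : (π : Trace n) → π ∈ 𝓛 universalBüchi
    ∈-universalBüchi π = proj₂ (𝓛-toBüchi universal) (_ , universal-run π)

    _∣ᴮ_ : Büchi n → Formula n → Büchi n
    A ∣ᴮ φ = toBüchi (Synchronous.cascade (fromBüchi A) (initially (tester φ)))

    𝓛-∣ᴮ : (A : Büchi n) (φ : Formula n) → 𝓛 (A ∣ᴮ φ) ≐ 𝓛 A ∩ (_⊨ φ)
    𝓛-∣ᴮ A φ = ≐-trans (𝓛-toBüchi _) (≐-trans (Lang-cascade _ _)
      ( Product.map (proj₁ (Lang-fromBüchi A)) (proj₁ (Lang-initially (tester φ)))
      , Product.map (proj₂ (Lang-fromBüchi A)) (proj₂ (Lang-initially (tester φ)))))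
      where open Synchronous

  _∪ᴮ_ : Büchi n → Büchi n → Büchi n
  A ∪ᴮ B = toBüchi (union (fromBüchi A) (fromBüchi B))

  supp-∪ᴮ : (A B : Büchi n) → supp (A ∪ᴮ B) ≐ supp A ∩ supp B
  supp-∪ᴮ A B =
    (λ φ∈ → (λ π π∈A → φ∈ π (proj₂ 𝓛-∪ᴮ (inj₁ π∈A))) , λ π π∈B → φ∈ π (proj₂ 𝓛-∪ᴮ (inj₂ π∈B)))
    , λ (φ∈A , φ∈B) π π∈ → [ φ∈A π , φ∈B π ]′ (proj₁ 𝓛-∪ᴮ π∈)
    where
    𝓛-∪ᴮ : 𝓛 (A ∪ᴮ B) ≐ 𝓛 A ∪ 𝓛 B
    𝓛-∪ᴮ = ≐-trans (𝓛-toBüchi (union (fromBüchi A) (fromBüchi B)))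
      (≐-trans (Lang-union (fromBüchi A) (fromBüchi B))
               ( Sum.map (proj₁ (Lang-fromBüchi A)) (proj₁ (Lang-fromBüchi B))
               , Sum.map (proj₂ (Lang-fromBüchi A)) (proj₂ (Lang-fromBüchi B))))

  module _ {X : FormulaSet n} {A : Büchi n} (X⊆A : X ⊆ supp A) where

    -- `Cn` speaks of finite structures and `supp` of single traces; the lasso bridges them. A trace
    -- of `A` refuting the implication makes `A ∣ᴮ χ` nonempty. It then contains all traces of some
    -- structure, which models `X` and `φ` but not `ψ`.
    deduction : ∀ {φ ψ} → ψ ∈ X + φ → ¬′ φ ∨′ ψ ∈ supp A
    deduction {φ} {ψ} ψ∈X+φ π π∈A = stable λ π⊭ →
      let M , (τ , τ∈M) , M⊆ = Lassos.nonempty⇒structure (A ∣ᴮ χ)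
            (π , proj₂ (𝓛-∣ᴮ A χ) (π∈A , π⊭))
          inA : Traces M ⊆ 𝓛 A ∩ (_⊨ χ)
          inA = proj₁ (𝓛-∣ᴮ A χ) ∘ M⊆
          models : ∀ θ → θ ∈ X ∪ ｛ φ ｝ → M ⊨ᴷ θ
          models = λ { θ (inj₁ θ∈X) τ τ∈M → X⊆A θ∈X τ (proj₁ (inA τ∈M))
                     ; θ (inj₂ refl) τ τ∈M → stable (proj₂ (inA τ∈M) ∘ inj₁) }
      in proj₂ (inA τ∈M) (inj₂ (ψ∈X+φ M models τ τ∈M))
      where χ = ¬′ (¬′ φ ∨′ ψ)

    Cn⊆supp : Cn X ⊆ supp A
    Cn⊆supp {ψ} ψ∈CnX π π∈A =
      -- With `¬′ ψ` as the added hypothesis, deduction yields a disjunction of a double negation of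
      -- `ψ` with `ψ` itself.
      [ stable , id ]′ (deduction {φ = ¬′ ψ} {ψ} (λ M h → ψ∈CnX M (λ θ → h θ ∘ inj₁)) π π∈A)

  Cn-extensive : {X : FormulaSet n} → X ⊆ Cn X
  Cn-extensive φ∈X M h = h _ φ∈X

  Cn-mono : {X Y : FormulaSet n} → X ⊆ Y → Cn X ⊆ Cn Y
  Cn-mono X⊆Y φ∈ M h = φ∈ M (λ ψ ψ∈X → h ψ (X⊆Y ψ∈X))

  Cn-𝔼 : {X : FormulaSet n} → X ∈ 𝔼Büchi → Cn X ⊆ X
  Cn-𝔼 (A , X⊆A , A⊆X) {φ} φ∈ = A⊆X (Cn⊆supp {A = A} X⊆A {φ} φ∈)

  𝔼-resp-≐ : {X Y : FormulaSet n} → X ≐ Y → Y ∈ 𝔼Büchi → X ∈ 𝔼Büchi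
  𝔼-resp-≐ {X = X} {Y} X≐Y (A , Y≐A) = A , ≐-trans {i = X} {j = Y} {k = supp A} X≐Y Y≐A

  𝔼-∩-supp : {X : FormulaSet n} → X ∈ 𝔼Büchi → (B : Büchi n) → (X ∩ supp B) ∈ 𝔼Büchi
  𝔼-∩-supp (A , X⊆A , A⊆X) B = A ∪ᴮ B
    , (λ {φ} (φ∈X , φ∈B) → proj₂ (supp-∪ᴮ A B) {φ} (X⊆A φ∈X , φ∈B))
    , λ {φ} φ∈ → let φ∈A , φ∈B = proj₁ (supp-∪ᴮ A B) {φ} φ∈ in A⊆X φ∈A , φ∈B

  module _ {φ ψ : Formula n} where

    ≣-sym : φ ≣ ψ → ψ ≣ φ
    ≣-sym = ≐-sym {x = Cn ｛ φ ｝} {y = Cn ｛ ψ ｝}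

    ≣⇒∈Cn : φ ≣ ψ → ψ ∈ Cn ｛ φ ｝
    ≣⇒∈Cn (_ , ψ⊆φ) = ψ⊆φ {ψ} (Cn-extensive {X = ｛ ψ ｝} refl)

    -- Equivalence is defined through finite structures. The deduction theorem over the universal
    -- automaton extends it to arbitrary traces, including those that are not ultimately periodic.
    ≣⇒⊨ : φ ≣ ψ → ∀ {π} → π ⊨ φ → π ⊨ ψ
    ≣⇒⊨ φ≣ψ {π} π⊨φ =
      [ (λ π⊭φ → contradiction π⊨φ π⊭φ) , id ]′
      (deduction {X = ∅} {A = universalBüchi} (λ ()) {φ} {ψ}
        (Cn-mono {X = ｛ φ ｝} inj₂ {ψ} (≣⇒∈Cn φ≣ψ)) π (∈-universalBüchi π))

    ≣-closed : {X : FormulaSet n} → Cn X ⊆ X → φ ≣ ψ → φ ∈ X → ψ ∈ X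
    ≣-closed {X} closed φ≣ψ φ∈X =
      closed {ψ} (Cn-mono {X = ｛ φ ｝} {Y = X} (λ { refl → φ∈X }) {ψ} (≣⇒∈Cn φ≣ψ))

  Cn-idem : {X : FormulaSet n} → Cn (Cn X) ⊆ Cn X
  Cn-idem φ∈ M h = φ∈ M (λ ψ ψ∈Cn → ψ∈Cn M h)

  ≣-tautology : {φ ψ : Formula n} → φ ≣ ψ → Tautology φ → Tautology ψ
  ≣-tautology {φ = φ} {ψ} = ≣-closed {φ = φ} {ψ} {X = Cn ∅} (λ {χ} → Cn-idem {X = ∅} {χ})

  -- Canonical representatives of equivalence classes

  least : {P : Pred ℕ 0ℓ} → ∃ P → ∃[ m ] P m × (∀ k → P k → m ≤ k)
  least {P} (m , p) = <-rec (λ m → P m → ∃[ m ] P m × (∀ k → P k → m ≤ k)) search m p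
    where
    search : ∀ m → (∀ {k} → k < m → P k → ∃[ m ] P m × (∀ k → P k → m ≤ k)) →
             P m → ∃[ m ] P m × (∀ k → P k → m ≤ k)
    search m rec p with em {∃[ k ] k < m × P k}
    ... | yes (k , k<m , pk) = rec k<m pk
    ... | no none = m , p , λ k pk → ≮⇒≥ (λ k<m → none (k , k<m , pk))

  -- Depends on P only up to ≐, which is what makes representatives of classes canonical.
  Selects : Pred (Formula n) 0ℓ → Formula n → Set
  Selects P φ = ∃[ h ] ∃[ rest ] filter (λ χ → em {P χ}) (formulae h) ≡ φ ∷ rest
                × (∀ k → (∃[ χ ] χ ∈ˡ formulae k × P χ) → h ≤ k)

  select : {P : Pred (Formula n) 0ℓ} → Satisfiable P → ∃ (Selects P)
  select {P = P} (φ , pφ) with least {λ h → ∃[ χ ] χ ∈ˡ formulae h × P χ}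
                                     (height φ , φ , ∈-formulae φ ≤-refl , pφ)
  ... | h , (χ , χ∈ , pχ) , h-least
    with filter (λ χ → em {P χ}) (formulae h) in eq
       | ∈-filter⁺ (λ χ → em {P χ}) χ∈ pχ
  -- The filtered list cannot be empty, because `χ` passes the filter.
  ... | χ₀ ∷ rest | _ = χ₀ , h , rest , eq , h-least

  selects-∈ : {P : Pred (Formula n) 0ℓ} → ∀ {φ} ((h , _) : Selects P φ) → φ ∈ˡ formulae h × P φ
  selects-∈ {P = P} (h , rest , eq , _) =
    ∈-filter⁻ (λ χ → em {P χ}) {xs = formulae h} (subst (_ ∈ˡ_) (sym eq) (here refl))

  -- Both stages are least for the same property, hence equal. Filtering one list by coextensive
  -- predicates gives one list, whichever proofs `em` returns, and so one head.
  selects-unique : {P Q : Pred (Formula n) 0ℓ} → ∀ {φ ψ} →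
                   P ≐ Q → Selects P φ → Selects Q ψ → φ ≡ ψ
  selects-unique {P = P} {Q} P≐Q p@(h , _ , eq , least) q@(k , _ , eq′ , least′)
    with ≤-antisym (least k (_ , map₂ (proj₂ P≐Q) (selects-∈ {P = Q} q)))
                   (least′ h (_ , map₂ (proj₁ P≐Q) (selects-∈ {P = P} p)))
  ... | refl = ∷-injectiveˡ (trans (sym eq) (trans
    (filter-≐ (λ χ → em {P χ}) (λ χ → em {Q χ}) P≐Q (formulae h)) eq′))

  representative : (φ : Formula n) → ∃ (Selects (φ ≣_))
  representative φ = select {P = φ ≣_} (φ , ≐-refl {x = Cn ｛ φ ｝})

  rep : Formula n → Formula n
  rep φ = proj₁ (representative φ)

  ≣-rep : (φ : Formula n) → φ ≣ rep φ
  ≣-rep φ = proj₂ (selects-∈ {P = φ ≣_} (proj₂ (representative φ)))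

  -- Equivalent formulae have coextensive classes. Obtaining equality, not only equivalence, lets a
  -- choice made at representatives respect `≣`.
  rep-cong : {φ ψ : Formula n} → φ ≣ ψ → rep φ ≡ rep ψ
  rep-cong {φ = φ} {ψ} φ≣ψ = selects-unique {P = φ ≣_} {Q = ψ ≣_}
    ((λ {χ} → ≐-trans {i = Cn ｛ ψ ｝} {j = Cn ｛ φ ｝} {k = Cn ｛ χ ｝} (≣-sym {φ = φ} {ψ} φ≣ψ))
    , λ {χ} → ≐-trans {i = Cn ｛ φ ｝} {j = Cn ｛ ψ ｝} {k = Cn ｛ χ ｝} φ≣ψ)
    (proj₂ (representative φ)) (proj₂ (representative ψ))

  -- Contractions

  Proper : FormulaSet n → Pred (Formula n) 0ℓ
  Proper K φ = φ ∉ Cn ∅ × φ ∈ K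

  proper-cong : {K : FormulaSet n} → Cn K ⊆ K → ∀ {φ ψ} → φ ≣ ψ → Proper K φ → Proper K ψ
  proper-cong closed {φ} {ψ} φ≣ψ (φ∉ , φ∈K) =
    φ∉ ∘ ≣-tautology (≣-sym {φ = φ} {ψ} φ≣ψ) , ≣-closed closed φ≣ψ φ∈K

  module _ {K : FormulaSet n} {γ : Formula n → Büchi n} {φ : Formula n} where

    induced-proper : Proper K φ → induced K γ φ ≐ K ∩ supp (γ φ)
    induced-proper p =
      [ proj₂ , (λ (¬p , _) → contradiction p ¬p) ]′ , λ ψ∈ → inj₁ (p , ψ∈)

    induced-improper : ¬ Proper K φ → induced K γ φ ≐ K
    induced-improper ¬p =
      [ (λ (p , _) → contradiction p ¬p) , proj₂ ]′ , λ ψ∈ → inj₂ (¬p , ψ∈)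

  non-tautology⇒refuted : (φ : Formula n) → ¬ Tautology φ → ∃[ π ] ¬ π ⊨ φ
  non-tautology⇒refuted φ φ∉ = stable λ none →
    φ∉ (λ M _ π _ → stable (λ π⊭φ → none (π , π⊭φ)))

  ∉supp⇒refuted : {A : Büchi n} {φ : Formula n} → φ ∉ supp A → ∃[ π ] π ∈ 𝓛 A × ¬ π ⊨ φ
  ∉supp⇒refuted φ∉ = stable λ none →
    φ∉ (λ π π∈A → stable (λ π⊭φ → none (π , π∈A , π⊭φ)))

  module _ {K : FormulaSet n} (K∈𝔼 : K ∈ 𝔼Büchi) {K∸_ : Contraction n} where

    -- From choice functions to rational contractions

    module _ {γ : Formula n → Büchi n} (γ-choice : IsBüchiChoice γ)
             (K∸≐induced : ∀ φ → (K∸ φ) ≐ induced K γ φ) where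
      open IsBüchiChoice γ-choice

      private
        K-closed : Cn K ⊆ K
        K-closed = Cn-𝔼 K∈𝔼

        proper : ∀ {φ} → Proper K φ → (K∸ φ) ≐ K ∩ supp (γ φ)
        proper p = ≐-trans (K∸≐induced _) (induced-proper {γ = γ} p)

        improper : ∀ {φ} → ¬ Proper K φ → (K∸ φ) ≐ K
        improper ¬p = ≐-trans (K∸≐induced _) (induced-improper {γ = γ} ¬p)

      induced-remains : RemainsIn𝔼Büchi K∸_
      induced-remains φ with em {Proper K φ}
      ... | yes p = 𝔼-resp-≐ (proper p) (𝔼-∩-supp K∈𝔼 (γ φ))
      ... | no ¬p = 𝔼-resp-≐ (improper ¬p) K∈𝔼

      induced-rational : Rational K K∸_
      induced-rational = record
        { closure        = λ φ → Cn-extensive , Cn-𝔼 (induced-remains φ)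
        ; inclusion      = inclusion
        ; vacuity        = λ φ φ∉K → improper (φ∉K ∘ proj₂)
        ; success        = success
        ; recovery       = recovery
        ; extensionality = extensionality′
        }
        where
        inclusion : ∀ φ → (K∸ φ) ⊆ K
        inclusion φ with em {Proper K φ}
        ... | yes p = proj₁ ∘ proj₁ (proper p)
        ... | no ¬p = proj₁ (improper ¬p)

        success : ∀ φ → φ ∉ Cn ∅ → φ ∉ (K∸ φ)
        success φ φ∉ φ∈K∸φ =
          -- A trace accepted by `γ φ` would satisfy both `φ` and its negation.
          let π , π∈ = nonempty φ
              _ , φ∈supp = proj₁ (proper (φ∉ , inclusion φ φ∈K∸φ)) φ∈K∸φ
          in refutes φ φ∉ π π∈ (φ∈supp π π∈)

        recovery : ∀ φ → K ⊆ (K∸ φ) + φ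
        recovery φ {ψ} ψ∈K with em {Proper K φ}
        ... | no ¬p = Cn-extensive (inj₁ (proj₂ (improper ¬p) ψ∈K))
        -- The implication from `φ` to `ψ` survives the contraction: it lies in `K` because `ψ`
        -- does, and in the support because `γ φ` refutes `φ`. Adding `φ` back recovers `ψ`.
        ... | yes p@(φ∉ , _) = λ M h π π∈M →
          [ (λ π⊭φ → contradiction (h φ (inj₂ refl) π π∈M) π⊭φ) , id ]′
          (h (¬′ φ ∨′ ψ) (inj₁ (proj₂ (proper p) (φ⇒ψ∈K , φ⇒ψ∈supp))) π π∈M)
          where
          φ⇒ψ∈K : ¬′ φ ∨′ ψ ∈ K
          φ⇒ψ∈K = K-closed λ M h π π∈M → inj₂ (h ψ ψ∈K π π∈M)
          φ⇒ψ∈supp : ¬′ φ ∨′ ψ ∈ supp (γ φ)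
          φ⇒ψ∈supp π π∈ = inj₁ (refutes φ φ∉ π π∈)

        extensionality-⊆ : ∀ φ ψ → φ ≣ ψ → (K∸ φ) ⊆ (K∸ ψ)
        extensionality-⊆ φ ψ φ≣ψ χ∈ with em {Proper K φ}
        ... | no ¬p = proj₂ (improper (¬p ∘ proper-cong K-closed (≣-sym {φ = φ} {ψ} φ≣ψ)))
                            (proj₁ (improper ¬p) χ∈)
        ... | yes p =
          let χ∈K , χ∈supp = proj₁ (proper p) χ∈
          in proj₂ (proper (proper-cong K-closed φ≣ψ p))
               (χ∈K , λ π π∈ → χ∈supp π (proj₂ (extensionality φ ψ φ≣ψ) π∈))

        extensionality′ : ∀ φ ψ → φ ≣ ψ → (K∸ φ) ≐ (K∸ ψ)
        extensionality′ φ ψ φ≣ψ =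
          extensionality-⊆ φ ψ φ≣ψ , extensionality-⊆ ψ φ (≣-sym {φ = φ} {ψ} φ≣ψ)

    -- From rational contractions to choice functions

    module _ (rational : Rational K K∸_) (remains : RemainsIn𝔼Büchi K∸_) where
      open Rational rational

      private
        K-closed : Cn K ⊆ K
        K-closed = Cn-𝔼 K∈𝔼

      improper⇒K : ∀ {φ} → ¬ Proper K φ → (K∸ φ) ≐ K
      improper⇒K {φ} ¬p with em {φ ∈ K}
      ... | no φ∉K  = vacuity φ φ∉K
      -- Here `φ` is a tautology, so adding it back gives nothing new and recovery already places
      -- `K` inside the closed set `K∸ φ`.
      ... | yes φ∈K = inclusion φ , λ ψ∈K → Cn-𝔼 (remains φ) λ M h →
        recovery φ ψ∈K M λ { θ (inj₁ θ∈)  → h θ θ∈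
                           ; θ (inj₂ refl) → stable (λ φ∉ → ¬p (φ∉ , φ∈K)) M (λ _ ()) }

      -- The demands on an automaton that concern one formula at a time. Respect for `≣` is obtained
      -- separately, by choosing at representatives.
      ContractsBy : Formula n → Büchi n → Set
      ContractsBy φ C = Satisfiable (𝓛 C)
                      × (¬ Tautology φ → ¬′ φ ∈ supp C)
                      × (Proper K φ → (K∸ φ) ≐ K ∩ supp C)

      -- Success provides a trace of `A` refuting `φ`. For a `ψ` in `K` and in the new support,
      -- split the traces of `A`: those refuting `φ` satisfy `ψ` by the support, the others by
      -- recovery and deduction.
      contracts-by-refuting : ∀ {φ} (A : Büchi n) → φ ∉ Cn ∅ → (K∸ φ) ≐ supp A →
                              ContractsBy φ (A ∣ᴮ (¬′ φ))
      contracts-by-refuting {φ} A φ∉ (K∸φ⊆A , A⊆K∸φ) =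
          (let π , π∈A , π⊭φ = ∉supp⇒refuted {A = A} {φ} (success φ φ∉ ∘ A⊆K∸φ)
           in π , proj₂ (𝓛-∣ᴮ A (¬′ φ)) (π∈A , π⊭φ))
        , (λ _ π → proj₂ ∘ proj₁ (𝓛-∣ᴮ A (¬′ φ)))
        , λ _ → (λ ψ∈ → inclusion φ ψ∈ , λ π → K∸φ⊆A ψ∈ π ∘ proj₁ ∘ proj₁ (𝓛-∣ᴮ A (¬′ φ)))
              , λ {ψ} (ψ∈K , ψ∈supp) → A⊆K∸φ λ π π∈A →
                  [ (λ π⊭φ → ψ∈supp π (proj₂ (𝓛-∣ᴮ A (¬′ φ)) (π∈A , π⊭φ))) , id ]′
                  (deduction {A = A} K∸φ⊆A {φ} {ψ} (recovery φ ψ∈K) π π∈A)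

      opaque
        contractor : ∀ φ → ∃ (ContractsBy φ)
        contractor φ with em {Tautology φ} | em {φ ∈ K}
        -- For a tautology only nonemptiness has content; the trace without any true atom witnesses
        -- it.
        ... | yes φ∈ | _       = universalBüchi
          , (const ⊥ₛ , ∈-universalBüchi (const ⊥ₛ))
          , contradiction φ∈ , λ (φ∉ , _) → contradiction φ∈ φ∉
        -- With `φ` outside `K` the contraction equation is vacuous, and all traces refuting `φ` may
        -- be accepted.
        ... | no φ∉  | no φ∉K  = universalBüchi ∣ᴮ (¬′ φ)
          , (let π , π⊭φ = non-tautology⇒refuted φ φ∉
             in π , proj₂ (𝓛-∣ᴮ universalBüchi (¬′ φ)) (∈-universalBüchi π , π⊭φ))
          , (λ _ π → proj₂ ∘ proj₁ (𝓛-∣ᴮ universalBüchi (¬′ φ)))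
          , λ (_ , φ∈K) → contradiction φ∈K φ∉K
        ... | no φ∉  | yes _   = let A , K∸φ≐A = remains φ
          in A ∣ᴮ (¬′ φ) , contracts-by-refuting A φ∉ K∸φ≐A

      choice : Formula n → Büchi n
      choice φ = proj₁ (contractor (rep φ))

      choice-isBüchiChoice : IsBüchiChoice choice
      choice-isBüchiChoice = record
        { nonempty       = λ φ → proj₁ (proj₂ (contractor (rep φ)))
        ; refutes        = λ φ φ∉ π π∈ π⊨φ →
            -- The automaton refutes the representative, to which equivalence transfers the truth of
            -- `φ` on the trace.
            proj₁ (proj₂ (proj₂ (contractor (rep φ))))
              (φ∉ ∘ ≣-tautology (≣-sym {φ = φ} {rep φ} (≣-rep φ)))
              π π∈ (≣⇒⊨ (≣-rep φ) π⊨φ)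
        ; extensionality = λ φ ψ φ≣ψ →
            subst (λ χ → 𝓛 (choice φ) ≐ 𝓛 (proj₁ (contractor χ))) (rep-cong φ≣ψ) (id , id)
        }

      choice-induces : ∀ φ → (K∸ φ) ≐ induced K choice φ
      choice-induces φ = [ proper , improper ]′ (toSum em)
        where
        improper : ¬ Proper K φ → (K∸ φ) ≐ induced K choice φ
        improper ¬p = ≐-trans {i = K∸ φ} {j = K} {k = induced K choice φ} (improper⇒K ¬p)
          (≐-sym {x = induced K choice φ} {y = K} (induced-improper {γ = choice} ¬p))
        proper : Proper K φ → (K∸ φ) ≐ induced K choice φ
        -- Extensionality of the contraction moves the claim to `rep φ`, for which the automaton was
        -- built.
        proper p = ≐-trans {i = K∸ φ} {j = K∸ rep φ} {k = induced K choice φ}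
          (extensionality φ (rep φ) (≣-rep φ))
          (≐-trans {i = K∸ rep φ} {j = K ∩ supp (choice φ)} {k = induced K choice φ}
            (proj₂ (proj₂ (proj₂ (contractor (rep φ))))
              (proper-cong {K = K} K-closed {φ} {rep φ} (≣-rep φ) p))
            (≐-sym {x = induced K choice φ} {y = K ∩ supp (choice φ)}
              (induced-proper {γ = choice} p)))

mainTheorem16 : ExcludedMiddle 0ℓ →
    (n : ℕ) .{{_ : NonZero n}} (K : FormulaSet n) → K ∈ 𝔼Büchi →
    (K∸_ : Contraction n) →
    (Rational K K∸_ × RemainsIn𝔼Büchi K∸_)
    ⇔ (∃[ γ ] IsBüchiChoice γ × (∀ φ → (K∸ φ) ≐ induced K γ φ))
mainTheorem16 em n K K∈𝔼 K∸_ = mk⇔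
  (λ (rational , remains) → choice K∈𝔼 rational remains
    , choice-isBüchiChoice K∈𝔼 rational remains , choice-induces K∈𝔼 rational remains)
  (λ (γ , γ-choice , eq) → induced-rational K∈𝔼 γ-choice eq , induced-remains K∈𝔼 γ-choice eq)
  where open Classical em
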